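{- Let $H_1,H_2$ be two graphs such that $S(H_1,k)S(H_2,k')\ge S(H_2,k)S(H_1,k')$ for all positive integers $k>k'$, with strict inequality for at least one pair $(k,k')$. Then $\mathcal{A}(G\cup H_1)>\mathcal{A}(G\cup H_2)$ for every graph $G$.
   Context: All graphs are finite, simple and undirected. A coloring of a graph $G$ assigns colors to its vertices so that adjacent vertices receive different colors; two colorings are equivalent if they induce the same partition of the vertex set into color classes. $S(G,k)$ denotes the number of non-equivalent colorings of $G$ using exactly $k$ colors (so $S(G,k)=0$ if $k$ exceeds the order of $G$). Set $\mathcal{B}(G)=\sum_{k\ge1}S(G,k)$, $\mathcal{T}(G)=\sum_{k\ge1}kS(G,k)$ and $\mathcal{A}(G)=\mathcal{T}(G)/\mathcal{B}(G)$. $G\cup H$ denotes disjoint union. -}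

module Defs where

open import Data.Nat using (ℕ; zero; suc; _+_; _*_; _<_; _≤_)
open import Data.Bool using (Bool; true; false; _∧_; not; if_then_else_)
open import Data.Fin using (Fin; splitAt; _≟_)
open import Data.Fin.Properties using () 
open import Data.List using (List; []; _∷_; concatMap; map; upTo)
open import Data.Bool.ListAction using (all; any)
open import Data.Nat.ListAction using (sum)
open import Data.Sum using (_⊎_; inj₁; inj₂)
open import Relation.Binary.PropositionalEquality using (_≡_; refl)
open import Relation.Nullary.Decidable using (⌊_⌋)
open import Data.Integer using (+_)
open import Data.Rational.Unnormalised using (ℚᵘ; mkℚᵘ; 0ℚᵘ)
import Data.List as L
import Data.Fin as F

record Graph : Set where
  field
    order : ℕ
    adj   : Fin order → Fin order → Bool
    sym   : ∀ x y → adj x y ≡ adj y x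
    irrefl : ∀ x → adj x x ≡ false
open Graph public

unionAdj : ∀ {n m} → (Fin n → Fin n → Bool) → (Fin m → Fin m → Bool)
         → Fin (n + m) → Fin (n + m) → Bool
unionAdj {n} a b x y with splitAt n x | splitAt n y
... | inj₁ x′ | inj₁ y′ = a x′ y′
... | inj₂ x′ | inj₂ y′ = b x′ y′
... | inj₁ _  | inj₂ _  = false
... | inj₂ _  | inj₁ _  = false

_∪_ : Graph → Graph → Graph
G ∪ H = record
  { order = order G + order H
  ; adj = unionAdj (adj G) (adj H)
  ; sym = s
  ; irrefl = i
  }
  where
  s : ∀ x y → unionAdj (adj G) (adj H) x y ≡ unionAdj (adj G) (adj H) y x
  s x y with splitAt (order G) x | splitAt (order G) y
  ... | inj₁ x′ | inj₁ y′ = sym G x′ y′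
  ... | inj₂ x′ | inj₂ y′ = sym H x′ y′
  ... | inj₁ _  | inj₂ _  = refl
  ... | inj₂ _  | inj₁ _  = refl
  i : ∀ x → unionAdj (adj G) (adj H) x x ≡ false
  i x with splitAt (order G) x
  ... | inj₁ x′ = irrefl G x′
  ... | inj₂ x′ = irrefl H x′

allFuns : (n k : ℕ) → List (Fin n → Fin k)
allFuns zero    k = (λ ()) ∷ []
allFuns (suc n) k =
  concatMap (λ f → map (λ c → λ { F.zero → c ; (F.suc i) → f i }) (L.allFin k))
            (allFuns n k)

_==_ : ∀ {k} → Fin k → Fin k → Bool
a == b = ⌊ a ≟ b ⌋

isProper : (G : Graph) {k : ℕ} → (Fin (order G) → Fin k) → Bool
isProper G c = all (λ x → all (λ y → not (adj G x y) Data.Bool.∨ not (c x == c y))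
                              (L.allFin (order G)))
                   (L.allFin (order G))

isSurjective : ∀ {n k} → (Fin n → Fin k) → Bool
isSurjective {n} {k} c = all (λ j → any (λ x → c x == j) (L.allFin n)) (L.allFin k)

kColorings : (G : Graph) (k : ℕ) → List (Fin (order G) → Fin k)
kColorings G k = L.filterᵇ (λ c → isProper G c ∧ isSurjective c) (allFuns (order G) k)

-- Two colorings are equivalent iff they induce the same partition of the
-- vertex set into color classes: c x = c y  ⇔  c' x = c' y  for all x, y.
boolEq : Bool → Bool → Bool
boolEq true  b = b
boolEq false b = not b

equivalent : ∀ {n k} → (Fin n → Fin k) → (Fin n → Fin k) → Bool
equivalent {n} c c′ =
  all (λ x → all (λ y → boolEq (c x == c y) (c′ x == c′ y)) (L.allFin n)) (L.allFin n)

-- Number of equivalence classes in a list (count the last member of each class).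
numClasses : ∀ {A : Set} → (A → A → Bool) → List A → ℕ
numClasses eq [] = 0
numClasses eq (x ∷ xs) = if any (eq x) xs then numClasses eq xs else suc (numClasses eq xs)

S : Graph → ℕ → ℕ
S G k = numClasses equivalent (kColorings G k)

-- B(G) = Σ_{k≥1} S(G,k), T(G) = Σ_{k≥1} k S(G,k); S(G,k)=0 for k > order G,
-- so summing over 1 ≤ k ≤ order G is the full sum.
ks : Graph → List ℕ
ks G = map suc (upTo (order G))

𝓑 : Graph → ℕ
𝓑 G = sum (map (S G) (ks G))

𝓣 : Graph → ℕ
𝓣 G = sum (map (λ k → k * S G k) (ks G))

-- A(G) = T(G)/B(G) as an (unnormalised) rational. Convention: 0 if B(G)=0
-- (only possible for the graph with no vertices).
𝓐 : Graph → ℚᵘ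
𝓐 G with 𝓑 G
... | zero  = 0ℚᵘ
... | suc b = mkℚᵘ (+ 𝓣 G) b

{-# OPTIONS --safe #-}
module Submission where

-- Grouping the n-colorings of G by their partition gives the chromatic polynomial
-- P(G,n) = Σ_k S(G,k) (n)_k. It is multiplicative under disjoint union, and falling-factorial
-- expansions are unique, so 𝓑(G ∪ H) = Σ_j S(H,j) b_j and 𝓣(G ∪ H) = Σ_j S(H,j) t_j, where
-- b_j and t_j are 𝓑 and 𝓣 of G ∪ K_j. If l runs over the numbers of classes avoiding the clique
-- in the colorings of G ∪ K_j, then t_{j+1} b_j − t_j b_{j+1} = b_j² + (b_j Σl² − (Σl)²) > 0 by
-- Cauchy–Schwarz, so t_j / b_j increases strictly. Averages of a strictly increasing function
-- respect the likelihood-ratio order between S(H₁,·) and S(H₂,·).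

open import Defs hiding (sym)
open import Data.Bool using (Bool; true; false; T; not; _∧_; _∨_; if_then_else_)
open import Data.Bool.ListAction using (all; any)
open import Data.Bool.Properties using (T-∧; T?)
open import Data.Empty using (⊥-elim)
open import Data.Fin using (Fin; zero; suc; _≟_; fromℕ<; punchIn; punchOut; splitAt; _↑ˡ_; _↑ʳ_)
open import Data.Fin.Properties
  using (any?; injective⇒≤; punchIn-injective; punchInᵢ≢i; punchIn-punchOut; punchOut-injective;
         suc-injective; splitAt-↑ˡ; splitAt-↑ʳ; splitAt⁻¹-↑ˡ; splitAt⁻¹-↑ʳ)
import Data.Integer as ℤ
open import Data.Integer using (+<+)
open import Data.Integer.Properties using (pos-*)
open import Data.List
  using (List; []; _∷_; [_]; _++_; map; concatMap; replicate; upTo; allFin; length; lookup; filterᵇ)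
open import Data.List.Membership.Propositional using (_∈_; find; lose)
open import Data.List.Membership.Propositional.Properties
  using (∈-map⁺; ∈-map⁻; ∈-concatMap⁺; ∈-concatMap⁻; ∈-filter⁺; ∈-filter⁻; ∈-allFin; ∈-upTo⁺;
         ∈-lookup; ∈-length)
open import Data.List.Properties
  using (length-map; length-++; length-tabulate; map-cong; map-∘; map-++; map-upTo)
open import Data.List.Relation.Unary.All as All using (All; []; _∷_)
open import Data.List.Relation.Unary.All.Properties using (all⁺; all⁻)
open import Data.List.Relation.Unary.AllPairs as AllPairs using (AllPairs; []; _∷_)
import Data.List.Relation.Unary.AllPairs.Properties as AllPairs
open import Data.List.Relation.Unary.Any using (here; there; index)
open import Data.List.Relation.Unary.Any.Properties using (any⁺; any⁻; lookup-index)
open import Data.List.Relation.Unary.Unique.Propositional.Properties using (allFin⁺; upTo⁺)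
open import Data.Nat hiding (_≟_)
open import Data.Nat.Combinatorics.Base using (_P′_)
open import Data.Nat.Combinatorics.Specification using (nP′k≡n[n∸1P′k∸1])
open import Data.Nat.ListAction using (sum)
open import Data.Nat.ListAction.Properties using (sum-++)
open import Data.Nat.Properties hiding (_≟_; suc-injective)
open import Data.Nat.Tactic.RingSolver using (solve-∀)
open import Data.Product using (∃; Σ; _×_; _,_; proj₁; proj₂)
open import Data.Rational.Unnormalised using (*<*) renaming (_<_ to _<ℚ_)
open import Data.Sum using (inj₁; inj₂; [_,_]′)
open import Data.Unit using (tt)
open import Data.Vec.Functional using () renaming (_∷_ to _▸_)
open import Function using (_∘_; id; const; flip; _⇔_; mk⇔)
open import Function.Bundles using (module Equivalence)
open import Relation.Binary.Definitions using (tri<; tri≈; tri>)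
open import Relation.Binary.PropositionalEquality hiding ([_])
open import Relation.Nullary using (¬_; Dec; yes; no)
open import Relation.Nullary.Decidable using (⌊_⌋)
open Equivalence using (to; from)

private variable
  X Y : Set
  m n k : ℕ

-- Finite sums

∑ : List X → (X → ℕ) → ℕ
∑ xs f = sum (map f xs)

∑-cong : {f g : X → ℕ} → f ≗ g → ∀ xs → ∑ xs f ≡ ∑ xs g
∑-cong f≗g xs = cong sum (map-cong f≗g xs)

∑-map : (g : X → Y) (f : Y → ℕ) (xs : List X) → ∑ (map g xs) f ≡ ∑ xs (f ∘ g)
∑-map g f xs = cong sum (sym (map-∘ xs))

∑-++ : (xs ys : List X) (f : X → ℕ) → ∑ (xs ++ ys) f ≡ ∑ xs f + ∑ ys f
∑-++ xs ys f = trans (cong sum (map-++ f xs ys)) (sum-++ (map f xs) (map f ys))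

∑-concatMap : (g : X → List Y) (f : Y → ℕ) (xs : List X) →
              ∑ (concatMap g xs) f ≡ ∑ xs (λ x → ∑ (g x) f)
∑-concatMap g f [] = refl
∑-concatMap g f (x ∷ xs) =
  trans (∑-++ (g x) (concatMap g xs) f) (cong (∑ (g x) f +_) (∑-concatMap g f xs))

∑-replicate : ∀ n (x : X) (f : X → ℕ) → ∑ (replicate n x) f ≡ n * f x
∑-replicate zero    x f = refl
∑-replicate (suc n) x f = cong (f x +_) (∑-replicate n x f)

∑-zero : (xs : List X) → ∑ xs (const 0) ≡ 0
∑-zero []       = refl
∑-zero (x ∷ xs) = ∑-zero xs

∑-const : ∀ c (xs : List X) → ∑ xs (const c) ≡ length xs * c
∑-const c []       = refl
∑-const c (_ ∷ xs) = cong (c +_) (∑-const c xs)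

∑-+ : (f g : X → ℕ) (xs : List X) → ∑ xs (λ x → f x + g x) ≡ ∑ xs f + ∑ xs g
∑-+ f g []       = refl
∑-+ f g (x ∷ xs) = trans (cong (f x + g x +_) (∑-+ f g xs)) (interchange (f x) (g x) _ _)
  where
  interchange : ∀ a b c d → a + b + (c + d) ≡ a + c + (b + d)
  interchange = solve-∀

∑-*ˡ : ∀ c (f : X → ℕ) xs → ∑ xs (λ x → c * f x) ≡ c * ∑ xs f
∑-*ˡ c f []       = sym (*-zeroʳ c)
∑-*ˡ c f (x ∷ xs) = trans (cong (c * f x +_) (∑-*ˡ c f xs)) (sym (*-distribˡ-+ c (f x) _))

∑-*ʳ : ∀ c (f : X → ℕ) xs → ∑ xs (λ x → f x * c) ≡ ∑ xs f * c
∑-*ʳ c f []       = refl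
∑-*ʳ c f (x ∷ xs) = trans (cong (f x * c +_) (∑-*ʳ c f xs)) (sym (*-distribʳ-+ c (f x) _))

∑-swap : (f : X → Y → ℕ) (xs : List X) (ys : List Y) →
         ∑ xs (λ x → ∑ ys (f x)) ≡ ∑ ys (λ y → ∑ xs (λ x → f x y))
∑-swap f []       ys = sym (∑-zero ys)
∑-swap f (x ∷ xs) ys =
  trans (cong (∑ ys (f x) +_) (∑-swap f xs ys)) (sym (∑-+ (f x) _ ys))

∑-*-∑ : (f : X → ℕ) (g : Y → ℕ) (xs : List X) (ys : List Y) →
        ∑ xs f * ∑ ys g ≡ ∑ xs (λ x → ∑ ys (λ y → f x * g y))
∑-*-∑ f g xs ys =
  trans (sym (∑-*ʳ (∑ ys g) f xs)) (∑-cong (λ x → sym (∑-*ˡ (f x) g ys)) xs)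

∑-mono-≤ : {f g : X → ℕ} → (∀ x → f x ≤ g x) → ∀ xs → ∑ xs f ≤ ∑ xs g
∑-mono-≤ f≤g []       = z≤n
∑-mono-≤ f≤g (x ∷ xs) = +-mono-≤ (f≤g x) (∑-mono-≤ f≤g xs)

∑-mono-< : {f g : X → ℕ} → (∀ x → f x ≤ g x) → ∀ {x xs} → x ∈ xs → f x < g x → ∑ xs f < ∑ xs g
∑-mono-< f≤g {xs = _ ∷ xs} (here refl) fx<gx = +-mono-<-≤ fx<gx (∑-mono-≤ f≤g xs)
∑-mono-< f≤g {xs = y ∷ _}  (there x∈)  fx<gx = +-mono-≤-< (f≤g y) (∑-mono-< f≤g x∈ fx<gx)

-- Double sums, rearrangement and Cauchy-Schwarz

module _ {F G : X → X → ℕ} (F≤G : ∀ x y → F x y + F y x ≤ G x y + G y x) where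

  private
    symmetrise : (H : X → X → ℕ) (xs : List X) →
      ∑ xs (λ x → ∑ xs (λ y → H x y + H y x)) ≡
      ∑ xs (λ x → ∑ xs (H x)) + ∑ xs (λ x → ∑ xs (H x))
    symmetrise H xs =
      trans (∑-cong (λ x → ∑-+ (H x) (λ y → H y x) xs) xs)
      (trans (∑-+ (λ x → ∑ xs (H x)) _ xs)
             (cong (∑ xs (λ x → ∑ xs (H x)) +_) (∑-swap (λ x y → H y x) xs xs)))

    halve-≤ : ∀ m n → m + m ≤ n + n → m ≤ n
    halve-≤ m n 2m≤2n = ≮⇒≥ λ n<m → ≤⇒≯ 2m≤2n (+-mono-< n<m n<m)

    halve-< : ∀ m n → m + m < n + n → m < n
    halve-< m n 2m<2n = ≰⇒> λ n≤m → <⇒≱ 2m<2n (+-mono-≤ n≤m n≤m)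

  -- Exchanging the two summation variables leaves a double sum unchanged, so twice each side is the
  -- sum of its symmetrised terms, and those compare termwise.
  ∑∑-mono-≤ : ∀ xs → ∑ xs (λ x → ∑ xs (F x)) ≤ ∑ xs (λ x → ∑ xs (G x))
  ∑∑-mono-≤ xs = halve-≤ _ _ (subst₂ _≤_ (symmetrise F xs) (symmetrise G xs)
    (∑-mono-≤ (λ x → ∑-mono-≤ (F≤G x) xs) xs))

  ∑∑-mono-< : ∀ {x y xs} → x ∈ xs → y ∈ xs → F x y + F y x < G x y + G y x →
              ∑ xs (λ x → ∑ xs (F x)) < ∑ xs (λ x → ∑ xs (G x))
  ∑∑-mono-< {x} {y} {xs} x∈ y∈ F<G = halve-< _ _ (subst₂ _<_ (symmetrise F xs) (symmetrise G xs)
    (∑-mono-< (λ x → ∑-mono-≤ (F≤G x) xs) x∈ (∑-mono-< (F≤G x) y∈ F<G)))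

-- With `x = y + d` and `u = v + e`, the two sides differ by `d * e`.
rearrangement : ∀ {x y u v} → y ≤ x → v ≤ u → y * u + x * v ≤ x * u + y * v
rearrangement {x} {y} {u} {v} y≤x v≤u
  rewrite sym (m+[n∸m]≡n y≤x) | sym (m+[n∸m]≡n v≤u) =
  ≤-trans (m≤m+n _ ((x ∸ y) * (u ∸ v))) (≤-reflexive (expand y v (x ∸ y) (u ∸ v)))
  where
  expand : ∀ y v d e → y * (v + e) + (y + d) * v + d * e ≡ (y + d) * (v + e) + y * v
  expand = solve-∀

rearrangement-< : ∀ {x y u v} → y < x → v < u → y * u + x * v < x * u + y * v
rearrangement-< {x} {y} {u} {v} y<x v<u
  rewrite sym (m+[n∸m]≡n y<x) | sym (m+[n∸m]≡n v<u) =
  <-≤-trans (m<m+n _ z<s) (≤-reflexive (expand y v (x ∸ suc y) (u ∸ suc v)))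
  where
  expand : ∀ y v d e → y * suc (v + e) + suc (y + d) * v + suc d * suc e ≡ suc (y + d) * suc (v + e) + y * v
  expand = solve-∀

-- This is `rearrangement` with both pairs equal, in the symmetrised form that `cauchy-schwarz`
-- needs; the factors `1` are the terms of `const 1`.
2xy≤x²+y² : ∀ x y → x * y + y * x ≤ x * x * 1 + y * y * 1
2xy≤x²+y² x y rewrite *-identityʳ (x * x) | *-identityʳ (y * y) with ≤-total x y
... | inj₁ x≤y = ≤-trans (rearrangement x≤y x≤y) (≤-reflexive (+-comm (y * y) (x * x)))
... | inj₂ y≤x = ≤-trans (≤-reflexive (+-comm (x * y) (y * x))) (rearrangement y≤x y≤x)

cauchy-schwarz : ∀ xs → ∑ xs id * ∑ xs id ≤ ∑ xs (λ x → x * x) * ∑ xs (const 1)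
cauchy-schwarz xs =
  subst₂ _≤_ (sym (∑-*-∑ id id xs xs)) (sym (∑-*-∑ (λ x → x * x) (const 1) xs xs))
         (∑∑-mono-≤ 2xy≤x²+y² xs)

-- Falling factorials

-- The definition of `_P′_` splits off the smallest factor. Splitting off the largest lowers both
-- arguments at once, as comparing expansions at `suc n` and `n` requires.
P′-suc-suc : ∀ n k → suc n P′ suc k ≡ suc n * (n P′ k)
P′-suc-suc n k = nP′k≡n[n∸1P′k∸1] (suc n) (suc k)

zero-P′-suc : ∀ k → 0 P′ suc k ≡ 0
zero-P′-suc k = cong (_* (0 P′ k)) (0∸n≡0 k)

n<k⇒nP′k≡0 : ∀ {n k} → n < k → n P′ k ≡ 0
n<k⇒nP′k≡0 {n} {suc k} (s≤s n≤k) = cong (_* (n P′ k)) (m≤n⇒m∸n≡0 n≤k)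

P′-shift : ∀ n j l → n P′ suc (j + l) + l * (n P′ (j + l)) ≡ (n P′ (j + l)) * (n ∸ j)
P′-shift n j l with j + l ≤? n
... | yes j+l≤n = trans (sym (*-distribʳ-+ (n P′ (j + l)) (n ∸ (j + l)) l))
  (trans (*-comm _ (n P′ (j + l))) (cong ((n P′ (j + l)) *_) shift))
  where
  shift : n ∸ (j + l) + l ≡ n ∸ j
  shift = trans (cong (_+ l) (sym (∸-+-assoc n j l)))
    (m∸n+n≡m (subst (_≤ n ∸ j) (m+n∸m≡n j l) (∸-monoˡ-≤ j j+l≤n)))
... | no j+l≰n rewrite n<k⇒nP′k≡0 (≰⇒> j+l≰n) | *-zeroʳ (n ∸ (j + l)) = *-zeroʳ l

zeros : List ℕ → ℕ
zeros []           = 0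
zeros (zero ∷ xs)  = suc (zeros xs)
zeros (suc _ ∷ xs) = zeros xs

preds : List ℕ → List ℕ
preds []           = []
preds (zero ∷ xs)  = preds xs
preds (suc x ∷ xs) = x ∷ preds xs

∑-zeros-preds : (h : ℕ → ℕ) → ∀ xs → ∑ xs h ≡ zeros xs * h 0 + ∑ (preds xs) (h ∘ suc)
∑-zeros-preds h []           = refl
∑-zeros-preds h (zero ∷ xs)  = trans (cong (h 0 +_) (∑-zeros-preds h xs)) (sym (+-assoc (h 0) _ _))
∑-zeros-preds h (suc x ∷ xs) =
  trans (cong (h (suc x) +_) (∑-zeros-preds h xs))
        (rotate (h (suc x)) (zeros xs * h 0) (∑ (preds xs) (h ∘ suc)))
  where
  rotate : ∀ a b c → a + (b + c) ≡ b + (a + c)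
  rotate = solve-∀

preds-bounded : ∀ {b xs} → All (_≤ suc b) xs → All (_≤ b) (preds xs)
preds-bounded []                        = []
preds-bounded {xs = zero ∷ _}  (_ ∷ ps) = preds-bounded ps
preds-bounded {xs = suc _ ∷ _} (s≤s p ∷ ps) = p ∷ preds-bounded ps

preds-zero : ∀ {xs} → All (_≤ 0) xs → preds xs ≡ []
preds-zero []                       = refl
preds-zero {zero ∷ _} (_ ∷ ps)      = preds-zero ps

bounded : ∀ xs → All (_≤ sum xs) xs
bounded []       = []
bounded (x ∷ xs) = m≤m+n x _ ∷ All.map (λ p → ≤-trans p (m≤n+m _ x)) (bounded xs)

∑-P′-zero : ∀ xs → ∑ xs (0 P′_) ≡ zeros xs
∑-P′-zero xs = trans (∑-zeros-preds (0 P′_) xs)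
  (trans (cong₂ _+_ (*-identityʳ (zeros xs))
                    (trans (∑-cong zero-P′-suc (preds xs)) (∑-zero (preds xs))))
         (+-identityʳ _))

∑-P′-suc : ∀ n xs → ∑ xs (suc n P′_) ≡ zeros xs + suc n * ∑ (preds xs) (n P′_)
∑-P′-suc n xs = trans (∑-zeros-preds (suc n P′_) xs)
  (cong₂ _+_ (*-identityʳ (zeros xs))
     (trans (∑-cong (P′-suc-suc n) (preds xs)) (∑-*ˡ (suc n) (n P′_) (preds xs))))

-- A list stands for a polynomial in the falling factorial basis, each entry being a basis index.
-- Evaluation at 0 yields the multiplicity of 0. At `suc n`, cancelling this constant term and the
-- factor `suc n` leaves the same hypothesis at `n` for the `preds` lists. Quantifying over `h`
-- expresses equality as multisets.
P′-expansion-unique′ : ∀ b {xs ys} → All (_≤ b) xs → All (_≤ b) ys →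
  (∀ n → ∑ xs (n P′_) ≡ ∑ ys (n P′_)) → (h : ℕ → ℕ) → ∑ xs h ≡ ∑ ys h
P′-expansion-unique′ b {xs} {ys} xs≤b ys≤b eq h =
  trans (∑-zeros-preds h xs)
  (trans (cong₂ _+_ (cong (_* h 0) zeros≡) (preds≡ b xs≤b ys≤b))
         (sym (∑-zeros-preds h ys)))
  where
  zeros≡ : zeros xs ≡ zeros ys
  zeros≡ = trans (sym (∑-P′-zero xs)) (trans (eq 0) (∑-P′-zero ys))

  preds-eq : ∀ n → ∑ (preds xs) (n P′_) ≡ ∑ (preds ys) (n P′_)
  preds-eq n = *-cancelˡ-≡ _ _ (suc n) (+-cancelˡ-≡ (zeros xs) _ _
    (trans (sym (∑-P′-suc n xs)) (trans (eq (suc n))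
      (trans (∑-P′-suc n ys) (cong (_+ suc n * ∑ (preds ys) (n P′_)) (sym zeros≡))))))

  -- Each passage to `preds` lowers the bound, which drives the recursion; at bound 0 both `preds`
  -- lists are empty.
  preds≡ : ∀ b → All (_≤ b) xs → All (_≤ b) ys → ∑ (preds xs) (h ∘ suc) ≡ ∑ (preds ys) (h ∘ suc)
  preds≡ zero    xs≤0 ys≤0 = cong (λ zs → ∑ zs (h ∘ suc)) (trans (preds-zero xs≤0) (sym (preds-zero ys≤0)))
  preds≡ (suc b) xs≤b ys≤b =
    P′-expansion-unique′ b (preds-bounded xs≤b) (preds-bounded ys≤b) preds-eq (h ∘ suc)

P′-expansion-unique : ∀ {xs ys} → (∀ n → ∑ xs (n P′_) ≡ ∑ ys (n P′_)) →
  (h : ℕ → ℕ) → ∑ xs h ≡ ∑ ys h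
P′-expansion-unique {xs} {ys} = P′-expansion-unique′ (sum xs + sum ys)
  (All.map (λ p → ≤-trans p (m≤m+n _ _)) (bounded xs))
  (All.map (λ p → ≤-trans p (m≤n+m _ _)) (bounded ys))

-- Adding clique vertices

-- If xs lists the numbers of classes of the colorings of G, then map (j +_) (extend xs j) lists
-- those of G ∪ K_j; an entry l counts the classes that avoid the clique. A new clique vertex
-- either forms its own class or joins one of these l classes.
extend : List ℕ → ℕ → List ℕ
extend xs zero    = xs
extend xs (suc j) = concatMap (λ l → l ∷ replicate l (pred l)) (extend xs j)

∑-extend-suc : ∀ xs j (h : ℕ → ℕ) →
  ∑ (extend xs (suc j)) h ≡ ∑ (extend xs j) (λ l → h l + l * h (pred l))
∑-extend-suc xs j h = trans (∑-concatMap (λ l → l ∷ replicate l (pred l)) h (extend xs j))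
  (∑-cong (λ l → cong (h l +_) (∑-replicate l (pred l) h)) (extend xs j))

-- At `l = 0` the truncated `pred` makes the two arguments of `h` differ, but the factor `l` is then
-- 0.
suc-+-pred : ∀ (h : ℕ → ℕ) j l → l * h (suc (j + pred l)) ≡ l * h (j + l)
suc-+-pred h j zero    = refl
suc-+-pred h j (suc l) = cong (λ k → suc l * h k) (sym (+-suc j l))

-- For the list of `G` this computes the chromatic polynomial of `G ∪ K_j`: by `P′-shift`, the two
-- options for a further clique vertex combine into the factor `n ∸ j`.
∑-extend-P′ : ∀ xs j n → ∑ (extend xs j) (λ l → n P′ (j + l)) ≡ (n P′ j) * ∑ xs (n P′_)
∑-extend-P′ xs zero    n = sym (+-identityʳ _)
∑-extend-P′ xs (suc j) n = begin
  ∑ (extend xs (suc j)) (λ l → n P′ suc (j + l))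
    ≡⟨ ∑-extend-suc xs j _ ⟩
  ∑ (extend xs j) (λ l → n P′ suc (j + l) + l * (n P′ suc (j + pred l)))
    ≡⟨ ∑-cong (λ l → trans (cong (n P′ suc (j + l) +_) (suc-+-pred (n P′_) j l)) (P′-shift n j l)) (extend xs j) ⟩
  ∑ (extend xs j) (λ l → (n P′ (j + l)) * (n ∸ j))
    ≡⟨ ∑-*ʳ (n ∸ j) _ (extend xs j) ⟩
  ∑ (extend xs j) (λ l → n P′ (j + l)) * (n ∸ j)
    ≡⟨ cong (_* (n ∸ j)) (∑-extend-P′ xs j n) ⟩
  (n P′ j) * ∑ xs (n P′_) * (n ∸ j)
    ≡⟨ rotate (n P′ j) _ (n ∸ j) ⟩
  (n ∸ j) * (n P′ j) * ∑ xs (n P′_) ∎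
  where
  open ≡-Reasoning
  rotate : ∀ a b c → a * b * c ≡ c * a * b
  rotate = solve-∀

module _ (xs : List ℕ) where

  -- For `xs = sizes G` these are the numbers b_j and t_j.
  count total : ℕ → ℕ
  count j = ∑ (extend xs j) (const 1)
  total j = ∑ (extend xs j) (j +_)

  count-suc : ∀ j → count (suc j) ≡ count j + ∑ (extend xs j) id
  count-suc j = trans (∑-extend-suc xs j _) (trans (∑-+ (const 1) (_* 1) ls)
    (cong (count j +_) (∑-cong *-identityʳ ls)))
    where ls = extend xs j

  count-pos : 0 < count 0 → ∀ j → 0 < count j
  count-pos p zero    = p
  count-pos p (suc j) = subst (0 <_) (sym (count-suc j)) (≤-trans (count-pos p j) (m≤m+n _ _))

  ∑-const+ : ∀ c ls → ∑ ls (c +_) ≡ c * ∑ ls (const 1) + ∑ ls id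
  ∑-const+ c ls = trans (∑-+ (const c) id ls) (cong (_+ ∑ ls id)
    (trans (∑-cong (λ _ → sym (*-identityʳ c)) ls) (∑-*ˡ c (const 1) ls)))

  -- An entry `l` contributes `suc (j + l)` once and `j + l` another `l` times, which brings in the
  -- second moment of `extend xs j`.
  total-suc : ∀ j → let ls = extend xs j in
    total (suc j) ≡ suc j * count j + ∑ ls id + (j * ∑ ls id + ∑ ls (λ l → l * l))
  total-suc j = trans (∑-extend-suc xs j _)
    (trans (∑-cong (λ l → cong (suc (j + l) +_) (suc-+-pred id j l)) ls)
    (trans (∑-+ (suc j +_) (λ l → l * (j + l)) ls)
    (cong₂ _+_ (∑-const+ (suc j) ls)
       (trans (∑-cong (λ l → trans (*-distribˡ-+ l j l) (cong (_+ l * l) (*-comm l j))) ls)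
       (trans (∑-+ (j *_) (λ l → l * l) ls) (cong (_+ ∑ ls (λ l → l * l)) (∑-*ˡ j id ls)))))))
    where ls = extend xs j

  ratio-suc : 0 < count 0 → ∀ j → total j * count (suc j) < total (suc j) * count j
  ratio-suc p j rewrite total-suc j | count-suc j | ∑-const+ j (extend xs j) =
    -- Adding `m₁ * m₁` to both sides avoids subtraction: the right side then exceeds the original
    -- left side by `m₀ * m₀ + m₂ * m₀`, and Cauchy-Schwarz bounds `m₁ * m₁` by `m₂ * m₀`.
    +-cancelʳ-< (m₁ * m₁) _ _
      (subst (((j * m₀ + m₁) * (m₀ + m₁) + m₁ * m₁) <_) (sym (expand j m₀ m₁ m₂))
        (+-monoʳ-< ((j * m₀ + m₁) * (m₀ + m₁))
          (+-mono-<-≤ (*-mono-< m₀>0 m₀>0) (cauchy-schwarz (extend xs j)))))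
    where
    m₀ = count j
    m₁ = ∑ (extend xs j) id
    m₂ = ∑ (extend xs j) (λ l → l * l)
    m₀>0 : 0 < m₀
    m₀>0 = count-pos p j
    expand : ∀ j m₀ m₁ m₂ → (suc j * m₀ + m₁ + (j * m₁ + m₂)) * m₀ + m₁ * m₁ ≡
                            (j * m₀ + m₁) * (m₀ + m₁) + (m₀ * m₀ + m₂ * m₀)
    expand = solve-∀

  -- Transitivity of the cross-multiplied comparisons: the chain carries a common factor `count j`,
  -- cancelled at the end. Strictness comes from the induction hypothesis and survives
  -- multiplication by the positive `count (suc j)`.
  ratio-increasing : 0 < count 0 → ∀ {i j} → i <′ j → total i * count j < total j * count i
  ratio-increasing p {i} <′-base = ratio-suc p i
  ratio-increasing p {i} (≤′-step {j} i<j) = *-cancelʳ-< (count j) _ _ (begin-strict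
    total i * count (suc j) * count j  ≡⟨ rotate (total i) _ _ ⟩
    total i * count j * count (suc j)
      <⟨ *-monoˡ-< (count (suc j)) {{>-nonZero (count-pos p (suc j))}} (ratio-increasing p i<j) ⟩
    total j * count i * count (suc j)  ≡⟨ rotate (total j) _ _ ⟩
    total j * count (suc j) * count i  ≤⟨ *-monoˡ-≤ (count i) (<⇒≤ (ratio-suc p j)) ⟩
    total (suc j) * count j * count i  ≡⟨ rotate (total (suc j)) _ _ ⟩
    total (suc j) * count i * count j  ∎)
    where
    open ≤-Reasoning
    rotate : ∀ a b c → a * b * c ≡ a * c * b
    rotate = solve-∀

-- Averages and the likelihood-ratio order

module _ (p q t b : ℕ → ℕ)
  (p≽q : ∀ {i j} → i < j → q j * p i ≤ p j * q i)
  (t/b-increasing : ∀ {i j} → i < j → t i * b j < t j * b i) where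

  private
    F G : ℕ → ℕ → ℕ
    F i j = (q i * t i) * (p j * b j)
    G i j = (p i * t i) * (q j * b j)

    F-sum : ∀ pᵢ pⱼ qᵢ qⱼ tᵢ tⱼ bᵢ bⱼ → qⱼ * pᵢ * (tⱼ * bᵢ) + pⱼ * qᵢ * (tᵢ * bⱼ) ≡
      (qᵢ * tᵢ) * (pⱼ * bⱼ) + (qⱼ * tⱼ) * (pᵢ * bᵢ)
    F-sum = solve-∀

    G-sum : ∀ pᵢ pⱼ qᵢ qⱼ tᵢ tⱼ bᵢ bⱼ → pⱼ * qᵢ * (tⱼ * bᵢ) + qⱼ * pᵢ * (tᵢ * bⱼ) ≡
      (pᵢ * tᵢ) * (qⱼ * bⱼ) + (pⱼ * tⱼ) * (qᵢ * bᵢ)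
    G-sum = solve-∀

    -- The difference of the symmetrised terms is `(p j * q i - q j * p i) * (t j * b i - t i * b
    -- j)`; both factors are nonnegative for `i < j`.
    F≤G-< : ∀ {i j} → i < j → F i j + F j i ≤ G i j + G j i
    F≤G-< {i} {j} i<j =
      subst₂ _≤_ (F-sum (p i) (p j) (q i) (q j) (t i) (t j) (b i) (b j))
                 (G-sum (p i) (p j) (q i) (q j) (t i) (t j) (b i) (b j))
        (rearrangement (p≽q i<j) (<⇒≤ (t/b-increasing i<j)))

    swap : ∀ a b c d → (a * b) * (c * d) ≡ (c * b) * (a * d)
    swap = solve-∀

    F≤G : ∀ i j → F i j + F j i ≤ G i j + G j i
    F≤G i j with <-cmp i j
    ... | tri< i<j _ _  = F≤G-< i<j
    ... | tri≈ _ refl _ = ≤-reflexive (cong₂ _+_ (swap (q i) (t i) (p i) (b i)) (swap (q i) (t i) (p i) (b i)))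
    ... | tri> _ _ j<i  = subst₂ _≤_ (+-comm (F j i) (F i j)) (+-comm (G j i) (G i j)) (F≤G-< j<i)

  -- A cross-multiplied comparison of averages of `t / b` with weights `p k * b k` and `q k * b k`.
  -- All pairs of indices compare weakly, so one strict pair makes the whole comparison strict.
  dominance : ∀ {i j js} → i ∈ js → j ∈ js → i < j → q j * p i < p j * q i →
    ∑ js (λ k → q k * t k) * ∑ js (λ k → p k * b k) <
    ∑ js (λ k → p k * t k) * ∑ js (λ k → q k * b k)
  dominance {i} {j} {js} i∈ j∈ i<j strict =
    subst₂ _<_ (sym (∑-*-∑ (λ k → q k * t k) (λ k → p k * b k) js js))
               (sym (∑-*-∑ (λ k → p k * t k) (λ k → q k * b k) js js))
      (∑∑-mono-< F≤G i∈ j∈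
        (subst₂ _<_ (F-sum (p i) (p j) (q i) (q j) (t i) (t j) (b i) (b j))
                    (G-sum (p i) (p j) (q i) (q j) (t i) (t j) (b i) (b j))
          (rearrangement-< strict (t/b-increasing i<j))))

-- Counting lists by bijection

AllPairs-concatMap : ∀ {P : X → X → Set} {Q : Y → Y → Set} {f : X → List Y} {xs} →
  AllPairs P xs → (∀ {x} → x ∈ xs → AllPairs Q (f x)) →
  (∀ {x x′} → x ∈ xs → x′ ∈ xs → P x x′ → ∀ {y y′} → y ∈ f x → y′ ∈ f x′ → Q y y′) →
  AllPairs Q (concatMap f xs)
AllPairs-concatMap [] _ _ = []
AllPairs-concatMap {f = f} {x ∷ xs} (px ∷ pxs) within across =
  AllPairs.++⁺ (within (here refl))
    (AllPairs-concatMap pxs (within ∘ there) (λ x∈ x′∈ → across (there x∈) (there x′∈)))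
    (All.tabulate λ y∈ → All.tabulate λ y′∈ →
      let x′ , x′∈ , y′∈fx′ = find (∈-concatMap⁻ f {xs = xs} y′∈)
      in across (here refl) (there x′∈) (All.lookup px x′∈) y∈ y′∈fx′)

length-concatMap : (f : X → List Y) → ∀ xs → length (concatMap f xs) ≡ ∑ xs (length ∘ f)
length-concatMap f []       = refl
length-concatMap f (x ∷ xs) =
  trans (length-++ (f x)) (cong (length (f x) +_) (length-concatMap f xs))

-- Counting goes through a relation because colorings are functions and are matched only pointwise.
-- Each position in `xs` selects a related position in `ys`; by the separation hypothesis no `y` is
-- related to two positions, so the selection is injective.
pigeonhole : (R : X → Y → Set) {xs : List X} {ys : List Y} →
  (∀ {x} → x ∈ xs → ∃ λ y → y ∈ ys × R x y) →
  AllPairs (λ x x′ → ∀ {y} → R x y → ¬ R x′ y) xs → length xs ≤ length ys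
pigeonhole R {xs} {ys} cover distinct = injective⇒≤ {f = image} λ {i} {j} → image-injective i j
  where
  image : Fin (length xs) → Fin (length ys)
  image i = index (proj₁ (proj₂ (cover (∈-lookup {xs = xs} i))))

  related : ∀ i → R (lookup xs i) (lookup ys (image i))
  related i with cover (∈-lookup {xs = xs} i)
  ... | y , y∈ , r = subst (R (lookup xs i)) (lookup-index y∈) r

  separated : ∀ {xs y} → AllPairs (λ x x′ → ∀ {y} → R x y → ¬ R x′ y) xs →
    ∀ i j → R (lookup xs i) y → R (lookup xs j) y → i ≡ j
  separated (px ∷ pxs) zero    zero    _ _  = refl
  separated (px ∷ pxs) zero    (suc j) r r′ = ⊥-elim (All.lookup px (∈-lookup j) r r′)
  separated (px ∷ pxs) (suc i) zero    r r′ = ⊥-elim (All.lookup px (∈-lookup i) r′ r)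
  separated (px ∷ pxs) (suc i) (suc j) r r′ = cong suc (separated pxs i j r r′)

  image-injective : ∀ i j → image i ≡ image j → i ≡ j
  image-injective i j eq = separated distinct i j (related i)
    (subst (λ z → R (lookup xs j) (lookup ys z)) (sym eq) (related j))

double-count : (R : X → Y → Set) {xs : List X} {ys : List Y} →
  (∀ {x} → x ∈ xs → ∃ λ y → y ∈ ys × R x y) →
  (∀ {y} → y ∈ ys → ∃ λ x → x ∈ xs × R x y) →
  AllPairs (λ x x′ → ∀ {y} → R x y → ¬ R x′ y) xs →
  AllPairs (λ y y′ → ∀ {x} → R x y → ¬ R x y′) ys → length xs ≡ length ys
double-count R coverˣ coverʸ distinctˣ distinctʸ =
  ≤-antisym (pigeonhole R coverˣ distinctˣ) (pigeonhole (flip R) coverʸ distinctʸ)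

-- Maps between finite sets

Injective : (Fin m → Fin n) → Set
Injective f = ∀ {x y} → f x ≡ f y → x ≡ y

Surjective : (Fin m → Fin n) → Set
Surjective f = ∀ j → ∃ λ x → f x ≡ j

infix 4 _≼_ _≈_ _≉_

-- Inclusion of kernels: the partition of `c` refines that of `d`. The codomains may differ, so that
-- a coloring can be compared with the surjection onto its classes.
_≼_ : {k l : ℕ} → (Fin n → Fin k) → (Fin n → Fin l) → Set
c ≼ d = ∀ {x y} → c x ≡ c y → d x ≡ d y

_≈_ : {k l : ℕ} → (Fin n → Fin k) → (Fin n → Fin l) → Set
c ≈ d = c ≼ d × d ≼ c

_≉_ : (Fin n → Fin k) → (Fin n → Fin k) → Set
f ≉ g = ¬ (f ≗ g)

≗⇒≈ : {f g : Fin n → Fin k} → f ≗ g → f ≈ g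
≗⇒≈ f≗g = (λ {x} {y} eq → trans (sym (f≗g x)) (trans eq (f≗g y))) ,
          (λ {x} {y} eq → trans (f≗g x) (trans eq (sym (f≗g y))))

injective-∘-≈ : {c : Fin n → Fin m} {r : Fin n → Fin k} {ι : Fin k → Fin m} →
  Injective ι → c ≗ ι ∘ r → c ≈ r
injective-∘-≈ {ι = ι} ι-inj c≗ιr =
  (λ {x} {y} eq → ι-inj (trans (sym (c≗ιr x)) (trans eq (c≗ιr y)))) ,
  (λ {x} {y} eq → trans (c≗ιr x) (trans (cong ι eq) (sym (c≗ιr y))))

-- Chosen preimages of distinct `j` are separated by `r`, hence by `s`. Applied both ways, this
-- shows that the kernel determines the number of classes.
≼-surjective⇒≤ : {l : ℕ} {r : Fin n → Fin k} {s : Fin n → Fin l} →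
  s ≼ r → Surjective r → k ≤ l
≼-surjective⇒≤ {s = s} s≼r surj = injective⇒≤ {f = λ j → s (proj₁ (surj j))}
  λ {i} {j} eq → trans (sym (proj₂ (surj i))) (trans (s≼r eq) (proj₂ (surj j)))

-- Induction on the vertices: `zero` either joins the class of a later vertex of the same color, or
-- opens a class numbered `zero` while the other numbers shift.
surjection : (c : Fin n → Fin m) → ∃ λ k → k ≤ n × Σ (Fin n → Fin k) λ r → Surjective r × c ≈ r
surjection {zero}  c = 0 , z≤n , (λ ()) , (λ ()) , (λ { {()} }) , λ { {()} }
surjection {suc n} c with surjection (c ∘ suc)
... | k , k≤n , r , surj , c≼r , r≼c with any? (λ i → c zero ≟ c (suc i))
... | yes (i , c₀≡cᵢ) = k , m≤n⇒m≤1+n k≤n , r i ▸ r , (λ j → suc (proj₁ (surj j)) , proj₂ (surj j))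
    , (λ {x} {y} → fwd x y) , (λ {x} {y} → bwd x y)
  where
  fwd : ∀ x y → c x ≡ c y → (r i ▸ r) x ≡ (r i ▸ r) y
  fwd zero    zero    eq = refl
  fwd zero    (suc y) eq = c≼r (trans (sym c₀≡cᵢ) eq)
  fwd (suc x) zero    eq = c≼r (trans eq c₀≡cᵢ)
  fwd (suc x) (suc y) eq = c≼r eq
  bwd : ∀ x y → (r i ▸ r) x ≡ (r i ▸ r) y → c x ≡ c y
  bwd zero    zero    eq = refl
  bwd zero    (suc y) eq = trans c₀≡cᵢ (r≼c eq)
  bwd (suc x) zero    eq = trans (r≼c eq) (sym c₀≡cᵢ)
  bwd (suc x) (suc y) eq = r≼c eq
... | no c₀∉ = suc k , s≤s k≤n , zero ▸ (suc ∘ r)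
    , (λ { zero → zero , refl ; (suc j) → suc (proj₁ (surj j)) , cong suc (proj₂ (surj j)) })
    , (λ {x} {y} → fwd x y) , (λ {x} {y} → bwd x y)
  where
  fwd : ∀ x y → c x ≡ c y → (zero ▸ (suc ∘ r)) x ≡ (zero ▸ (suc ∘ r)) y
  fwd zero    zero    eq = refl
  fwd zero    (suc y) eq = ⊥-elim (c₀∉ (y , eq))
  fwd (suc x) zero    eq = ⊥-elim (c₀∉ (x , sym eq))
  fwd (suc x) (suc y) eq = cong suc (c≼r eq)
  bwd : ∀ x y → (zero ▸ (suc ∘ r)) x ≡ (zero ▸ (suc ∘ r)) y → c x ≡ c y
  bwd zero    zero    eq = refl
  bwd zero    (suc y) ()
  bwd (suc x) zero    ()
  bwd (suc x) (suc y) eq = r≼c (suc-injective eq)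

-- Enumerating functions and injections

allFuns-complete : ∀ n {k} (f : Fin n → Fin k) → ∃ λ g → g ∈ allFuns n k × g ≗ f
allFuns-complete zero    f = _ , here refl , λ ()
allFuns-complete (suc n) f with allFuns-complete n (f ∘ suc)
... | g , g∈ , g≗f = _ , ∈-concatMap⁺ _ (lose g∈ (∈-map⁺ _ (∈-allFin (f zero)))) ,
                     λ { zero → refl ; (suc i) → g≗f i }

allFuns-distinct : ∀ n k → AllPairs _≉_ (allFuns n k)
allFuns-distinct zero    k = [] ∷ []
allFuns-distinct (suc n) k = AllPairs-concatMap (allFuns-distinct n k)
  (λ _ → AllPairs.map⁺ (AllPairs.map (λ c≢d eq → c≢d (eq zero)) (allFin⁺ k)))
  λ _ _ f≉g h∈ h′∈ h≗h′ → f≉g (tails (λ _ _ → refl) (λ _ _ → refl) h∈ h′∈ h≗h′)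
  where
  -- The entries of `allFuns` are built by an anonymous function inside its definition. It is passed
  -- as `e` and `e′`, and only its values at successors are used.
  tails : ∀ {f g} {e e′ : Fin k → Fin (suc n) → Fin k} {h h′} →
    (∀ c i → e c (suc i) ≡ f i) → (∀ c i → e′ c (suc i) ≡ g i) →
    h ∈ map e (allFin k) → h′ ∈ map e′ (allFin k) → h ≗ h′ → f ≗ g
  tails e-tail e′-tail h∈ h′∈ h≗h′ i with ∈-map⁻ _ h∈ | ∈-map⁻ _ h′∈
  ... | c , _ , refl | d , _ , refl = trans (sym (e-tail c i)) (trans (h≗h′ (suc i)) (e′-tail d i))

injections : ∀ k n → List (Fin k → Fin n)
injections zero    n       = [ (λ ()) ]
injections (suc k) zero    = []
injections (suc k) (suc n) =
  concatMap (λ c → map (λ ι → c ▸ (punchIn c ∘ ι)) (injections k n)) (allFin (suc n))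

length-injections : ∀ k n → length (injections k n) ≡ n P′ k
length-injections zero    n       = refl
length-injections (suc k) zero    = sym (zero-P′-suc k)
length-injections (suc k) (suc n) = begin
  length (injections (suc k) (suc n))
    ≡⟨ length-concatMap (λ c → map (λ ι → c ▸ (punchIn c ∘ ι)) (injections k n)) (allFin (suc n)) ⟩
  ∑ (allFin (suc n)) (λ c → length (map (λ ι → c ▸ (punchIn c ∘ ι)) (injections k n)))
    ≡⟨ ∑-cong (λ c → trans (length-map _ (injections k n)) (length-injections k n)) (allFin (suc n)) ⟩
  ∑ (allFin (suc n)) (const (n P′ k))
    ≡⟨ ∑-const (n P′ k) (allFin (suc n)) ⟩
  length (allFin (suc n)) * (n P′ k)
    ≡⟨ cong (_* (n P′ k)) (length-tabulate {n = suc n} id) ⟩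
  suc n * (n P′ k)
    ≡⟨ P′-suc-suc n k ⟨
  suc n P′ suc k ∎
  where open ≡-Reasoning

▸-injective : {c : Fin (suc n)} {ι : Fin k → Fin n} → Injective ι → Injective (c ▸ (punchIn c ∘ ι))
▸-injective         inj {zero}  {zero}  eq = refl
▸-injective {c = c} inj {zero}  {suc y} eq = ⊥-elim (punchInᵢ≢i c _ (sym eq))
▸-injective {c = c} inj {suc x} {zero}  eq = ⊥-elim (punchInᵢ≢i c _ eq)
▸-injective {c = c} inj {suc x} {suc y} eq = cong suc (inj (punchIn-injective c _ _ eq))

∈-injections⇒injective : ∀ k n {ι} → ι ∈ injections k n → Injective ι
∈-injections⇒injective zero    n _ {()}
∈-injections⇒injective (suc k) (suc n) ι∈ with find (∈-concatMap⁻ _ {xs = allFin (suc n)} ι∈)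
... | c , _ , ι∈c with ∈-map⁻ _ ι∈c
... | ι′ , ι′∈ , refl = ▸-injective (∈-injections⇒injective k n ι′∈)

injections-complete : ∀ k n (f : Fin k → Fin n) → Injective f → ∃ λ ι → ι ∈ injections k n × ι ≗ f
injections-complete zero    n       f inj = _ , here refl , λ ()
injections-complete (suc k) zero    f inj with () ← f zero
injections-complete (suc k) (suc n) f inj
  with injections-complete k n (λ i → punchOut (f₀≢f i))
         (λ {i} {j} eq → suc-injective (inj (punchOut-injective (f₀≢f i) (f₀≢f j) eq)))
  where
  f₀≢f : ∀ i → f zero ≢ f (suc i)
  f₀≢f i eq with () ← inj eq
... | ι , ι∈ , ι≗ = f zero ▸ (punchIn (f zero) ∘ ι)
    , ∈-concatMap⁺ _ (lose (∈-allFin (f zero)) (∈-map⁺ _ ι∈))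
    , λ { zero → refl ; (suc i) → trans (cong (punchIn (f zero)) (ι≗ i)) (punchIn-punchOut _) }

injections-distinct : ∀ k n → AllPairs _≉_ (injections k n)
injections-distinct zero    n       = [] ∷ []
injections-distinct (suc k) zero    = []
injections-distinct (suc k) (suc n) = AllPairs-concatMap (allFin⁺ (suc n))
  (λ {c} _ → AllPairs.map⁺ (AllPairs.map
    (λ ι≉ eq → ι≉ λ i → punchIn-injective c _ _ (eq (suc i))) (injections-distinct k n)))
  λ _ _ c≢d h∈ h′∈ eq → c≢d (heads h∈ h′∈ eq)
  where
  heads : ∀ {c d h h′} → h ∈ map (λ ι → c ▸ (punchIn c ∘ ι)) (injections k n) →
          h′ ∈ map (λ ι → d ▸ (punchIn d ∘ ι)) (injections k n) → h ≗ h′ → c ≡ d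
  heads h∈ h′∈ eq with ∈-map⁻ _ h∈ | ∈-map⁻ _ h′∈
  ... | _ , _ , refl | _ , _ , refl = eq zero

-- Colorings and partitions

T-all : {p : Fin n → Bool} → T (all p (allFin n)) ⇔ (∀ x → T (p x))
T-all {p = p} = mk⇔ (λ t x → All.lookup (all⁺ p (allFin _) t) (∈-allFin x))
                    (λ t → all⁻ p {xs = allFin _} (All.tabulate (λ {x} _ → t x)))

T-any : {p : Fin n → Bool} → T (any p (allFin n)) ⇔ ∃ (T ∘ p)
T-any {p = p} = mk⇔ (λ t → let x , _ , px = find (any⁻ p (allFin _) t) in x , px)
                    (λ (x , px) → any⁺ p (lose (∈-allFin x) px))

T-≟ : {a b : Fin n} → T (a == b) ⇔ a ≡ b
T-≟ {a = a} {b} with a ≟ b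
... | yes eq = mk⇔ (const eq) (const tt)
... | no neq = mk⇔ (λ ()) neq

T-implies-not : ∀ b {P : Set} (P? : Dec P) → T (not b ∨ not ⌊ P? ⌋) ⇔ (T b → ¬ P)
T-implies-not false P?       = mk⇔ (λ _ ()) (const tt)
T-implies-not true  (yes p)  = mk⇔ (λ ()) (λ f → f tt p)
T-implies-not true  (no ¬p)  = mk⇔ (λ _ _ → ¬p) (const tt)

T-boolEq : {P Q : Set} (P? : Dec P) (Q? : Dec Q) → T (boolEq ⌊ P? ⌋ ⌊ Q? ⌋) ⇔ ((P → Q) × (Q → P))
T-boolEq (yes p) (yes q) = mk⇔ (λ _ → const q , const p) (const tt)
T-boolEq (yes p) (no ¬q) = mk⇔ (λ ()) (λ (f , _) → ¬q (f p))
T-boolEq (no ¬p) (yes q) = mk⇔ (λ ()) (λ (_ , g) → ¬p (g q))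
T-boolEq (no ¬p) (no ¬q) = mk⇔ (λ _ → (λ p → ⊥-elim (¬p p)) , (λ q → ⊥-elim (¬q q))) (const tt)

Proper : (G : Graph) → (Fin (order G) → Fin k) → Set
Proper G c = ∀ {x y} → T (adj G x y) → c x ≢ c y

isProper⇔Proper : ∀ G {c : Fin (order G) → Fin k} → T (isProper G c) ⇔ Proper G c
isProper⇔Proper G {c} = mk⇔
  (λ t {x} {y} → to (T-implies-not (adj G x y) (c x ≟ c y)) (to T-all (to T-all t x) y))
  (λ f → from T-all λ x → from T-all λ y → from (T-implies-not (adj G x y) (c x ≟ c y)) f)

isSurjective⇔Surjective : {c : Fin n → Fin k} → T (isSurjective c) ⇔ Surjective c
isSurjective⇔Surjective = mk⇔
  (λ t j → let x , eq = to T-any (to T-all t j) in x , to T-≟ eq)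
  (λ surj → from T-all λ j → from T-any (proj₁ (surj j) , from T-≟ (proj₂ (surj j))))

equivalent⇔≈ : {c d : Fin n → Fin k} → T (equivalent c d) ⇔ c ≈ d
equivalent⇔≈ {c = c} {d} = mk⇔
  (λ t → (λ {x} {y} → proj₁ (at t x y)) , (λ {x} {y} → proj₂ (at t x y)))
  (λ c≈d → from T-all λ x → from T-all λ y → from (T-boolEq (c x ≟ c y) (d x ≟ d y)) (instantiate c≈d x y))
  where
  instantiate : c ≈ d → ∀ x y → (c x ≡ c y → d x ≡ d y) × (d x ≡ d y → c x ≡ c y)
  instantiate (c≼d , d≼c) x y = c≼d , d≼c
  at : T (equivalent c d) → ∀ x y → (c x ≡ c y → d x ≡ d y) × (d x ≡ d y → c x ≡ c y)
  at t x y = to (T-boolEq (c x ≟ c y) (d x ≟ d y)) (to T-all (to T-all t x) y)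

Proper-≼ : ∀ G {l} {c : Fin (order G) → Fin k} {d : Fin (order G) → Fin l} → d ≼ c → Proper G c → Proper G d
Proper-≼ G d≼c proper xy eq = proper xy (d≼c eq)

colorings : (G : Graph) (k : ℕ) → List (Fin (order G) → Fin k)
colorings G k = filterᵇ (isProper G) (allFuns (order G) k)

colorings-complete : ∀ G {c : Fin (order G) → Fin k} → Proper G c → ∃ λ d → d ∈ colorings G k × d ≗ c
colorings-complete G {c} proper with allFuns-complete (order G) c
... | d , d∈ , d≗c = d
    , ∈-filter⁺ (T? ∘ isProper G) d∈ (from (isProper⇔Proper G) (Proper-≼ G (proj₁ (≗⇒≈ d≗c)) proper))
    , d≗c

∈-colorings⇒Proper : ∀ G {c : Fin (order G) → Fin k} → c ∈ colorings G k → Proper G c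
∈-colorings⇒Proper {k} G c∈ =
  to (isProper⇔Proper G) (proj₂ (∈-filter⁻ (T? ∘ isProper G) {xs = allFuns (order G) k} c∈))

colorings-distinct : ∀ G k → AllPairs _≉_ (colorings G k)
colorings-distinct G k = AllPairs.filter⁺ (T? ∘ isProper G) (allFuns-distinct (order G) k)

kColorings-complete : ∀ G {c : Fin (order G) → Fin k} → Proper G c → Surjective c →
  ∃ λ d → d ∈ kColorings G k × d ≗ c
kColorings-complete G {c} proper surj with allFuns-complete (order G) c
... | d , d∈ , d≗c = d
    , ∈-filter⁺ (λ c → T? (isProper G c ∧ isSurjective c)) d∈
        (from T-∧ ( from (isProper⇔Proper G) (Proper-≼ G (proj₁ (≗⇒≈ d≗c)) proper)
                  , from isSurjective⇔Surjective λ j → proj₁ (surj j) , trans (d≗c _) (proj₂ (surj j))))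
    , d≗c

∈-kColorings⇒ : ∀ G {c : Fin (order G) → Fin k} → c ∈ kColorings G k → Proper G c × Surjective c
∈-kColorings⇒ {k} G c∈ 
  with to T-∧ (proj₂ (∈-filter⁻ (λ c → T? (isProper G c ∧ isSurjective c))
                        {xs = allFuns (order G) k} c∈))
... | p , s = to (isProper⇔Proper G) p , to isSurjective⇔Surjective s

module _ (eq : X → X → Bool) where

  -- Follows the recursion of `numClasses`, keeping the last member of each class, so that its
  -- length is the class count.
  representatives : List X → List X
  representatives []       = []
  representatives (x ∷ xs) = if any (eq x) xs then representatives xs else x ∷ representatives xs

  length-representatives : ∀ xs → length (representatives xs) ≡ numClasses eq xs
  length-representatives []       = refl
  length-representatives (x ∷ xs) with any (eq x) xs
  ... | true  = length-representatives xs
  ... | false = cong suc (length-representatives xs)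

  representatives-⊆ : ∀ xs {x} → x ∈ representatives xs → x ∈ xs
  representatives-⊆ (y ∷ xs) x∈ with any (eq y) xs
  representatives-⊆ (y ∷ xs) x∈         | true  = there (representatives-⊆ xs x∈)
  representatives-⊆ (y ∷ xs) (here px)  | false = here px
  representatives-⊆ (y ∷ xs) (there x∈) | false = there (representatives-⊆ xs x∈)

  representatives-distinct : ∀ xs → AllPairs (λ x y → ¬ T (eq x y)) (representatives xs)
  representatives-distinct []       = []
  representatives-distinct (x ∷ xs) with any (eq x) xs in none
  ... | true  = representatives-distinct xs
  ... | false = All.tabulate (λ y∈ x~y → subst T none (any⁺ (eq x) (lose (representatives-⊆ xs y∈) x~y)))
              ∷ representatives-distinct xs

  -- A dropped element is equivalent to some later one, whose representative then serves for both by
  -- transitivity.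
  representatives-cover : (∀ x → T (eq x x)) → (∀ {x y z} → T (eq x y) → T (eq y z) → T (eq x z)) →
    ∀ xs {x} → x ∈ xs → ∃ λ r → r ∈ representatives xs × T (eq x r)
  representatives-cover eq-refl eq-trans = cover
    where
    cover : ∀ xs {x} → x ∈ xs → ∃ λ r → r ∈ representatives xs × T (eq x r)
    cover (y ∷ xs) x∈ with any (eq y) xs in some
    cover (y ∷ xs) (there x∈)  | true = cover xs x∈
    cover (y ∷ xs) (here refl) | true =
      let z , z∈ , y~z = find (any⁻ (eq y) xs (subst T (sym some) tt))
          r , r∈ , z~r = cover xs z∈
      in r , r∈ , eq-trans y~z z~r
    cover (y ∷ xs) (here refl) | false = y , here refl , eq-refl y
    cover (y ∷ xs) (there x∈)  | false = let r , r∈ , x~r = cover xs x∈ in r , there r∈ , x~r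

classes : (G : Graph) (k : ℕ) → List (Fin (order G) → Fin k)
classes G k = representatives equivalent (kColorings G k)

classes-cover : ∀ G {c : Fin (order G) → Fin k} → c ∈ kColorings G k → ∃ λ r → r ∈ classes G k × c ≈ r
classes-cover {k} G c∈
  with r , r∈ , c~r ← representatives-cover equivalent
    (λ c → from (equivalent⇔≈ {c = c}) (id , id))
    (λ {c} {d} {e} c~d d~e →
      let c≼d , d≼c = to (equivalent⇔≈ {c = c} {d}) c~d
          d≼e , e≼d = to (equivalent⇔≈ {c = d} {e}) d~e
      in from (equivalent⇔≈ {c = c} {e}) ((λ eq → d≼e (c≼d eq)) , (λ eq → d≼c (e≼d eq))))
    (kColorings G k) c∈ = r , r∈ , to equivalent⇔≈ c~r

-- A partition of the vertex set is encoded as a surjection onto its set of classes.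
Partition : Graph → Set
Partition G = ∃ λ k → Fin (order G) → Fin k

-- `K` is an exclusive bound on the number of classes. It stays free so that the expansions for two
-- different graphs can share one index range.
partitions : (G : Graph) → ℕ → List (Partition G)
partitions G K = concatMap (λ k → map (k ,_) (classes G k)) (upTo K)

∑-partitions : ∀ G K (h : ℕ → ℕ) → ∑ (partitions G K) (h ∘ proj₁) ≡ ∑ (upTo K) (λ k → S G k * h k)
∑-partitions G K h =
  trans (∑-concatMap (λ k → map (k ,_) (classes G k)) (h ∘ proj₁) (upTo K))
        (∑-cong (λ k → trans (∑-map {Y = Partition G} (k ,_) (h ∘ proj₁) (classes G k))
                      (trans (∑-const (h k) (classes G k))
                             (cong (_* h k) (length-representatives equivalent (kColorings G k)))))
                (upTo K))

∈-partitions⇒ : ∀ G K {k r} → (k , r) ∈ partitions G K → Proper G r × Surjective r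
∈-partitions⇒ G K kr∈ with find (∈-concatMap⁻ _ {xs = upTo K} kr∈)
... | k , _ , r∈ with ∈-map⁻ _ r∈
... | r , r∈ , refl = ∈-kColorings⇒ G (representatives-⊆ equivalent (kColorings G k) r∈)

partitions-complete : ∀ G K → order G < K → {c : Fin (order G) → Fin n} → Proper G c →
  ∃ λ k → ∃ λ r → (k , r) ∈ partitions G K × c ≈ r
partitions-complete G K N<K {c} proper with surjection c
... | k , k≤N , s , surj , c≼s , s≼c
  with d , d∈ , d≗s ← kColorings-complete G (Proper-≼ G s≼c proper) surj
  with r , r∈ , d≼r , r≼d ← classes-cover G d∈
  with d≼s , s≼d ← ≗⇒≈ d≗s =
    k , r
  , ∈-concatMap⁺ _ (lose (∈-upTo⁺ (≤-<-trans k≤N N<K)) (∈-map⁺ _ r∈))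
  , (λ eq → d≼r (s≼d (c≼s eq))) , (λ eq → s≼c (d≼s (r≼d eq)))

-- For equal `k`, representatives are inequivalent. For different `k`, equal kernels are excluded
-- because they would force equal numbers of classes.
partitions-distinct : ∀ G K → AllPairs (λ (_ , r) (_ , s) → ¬ r ≈ s) (partitions G K)
partitions-distinct G K = AllPairs-concatMap (upTo⁺ K)
  (λ {k} _ → AllPairs.map⁺ (AllPairs.map (λ r≁s r≈s → r≁s (from equivalent⇔≈ r≈s))
                             (representatives-distinct equivalent (kColorings G k))))
  λ {k} {l} k∈ l∈ k≢l r∈ s∈ (r≼s , s≼r) → k≢l (same-size k∈ l∈ r∈ s∈ r≼s s≼r)
  where
  same-size : ∀ {k l i j} {r : Fin (order G) → Fin i} {s : Fin (order G) → Fin j} → k ∈ upTo K → l ∈ upTo K →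
    (i , r) ∈ map (k ,_) (classes G k) → (j , s) ∈ map (l ,_) (classes G l) → r ≼ s → s ≼ r → k ≡ l
  same-size {k} {l} k∈ l∈ r∈ s∈ r≼s s≼r
    with _ , surjʳ ← ∈-partitions⇒ G K (∈-concatMap⁺ _ (lose k∈ r∈))
       | _ , surjˢ ← ∈-partitions⇒ G K (∈-concatMap⁺ _ (lose l∈ s∈))
    with _ , _ , refl ← ∈-map⁻ _ r∈ | _ , _ , refl ← ∈-map⁻ _ s∈ =
      ≤-antisym (≼-surjective⇒≤ s≼r surjʳ) (≼-surjective⇒≤ r≼s surjˢ)

-- The chromatic polynomial

chromatic : Graph → ℕ → ℕ
chromatic G n = length (colorings G n)

-- Each proper coloring factors uniquely as `ι ∘ r` with `r` a listed partition and `ι` injective: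
-- the kernel fixes `r`, and surjectivity of `r` then fixes `ι`. A partition into `k` classes admits
-- `n P′ k` choices of `ι`.
chromatic-expansion : ∀ G K → order G < K → ∀ n → chromatic G n ≡ ∑ (partitions G K) (λ (k , _) → n P′ k)
chromatic-expansion G K N<K n = trans
  (double-count Factors coverˡ coverʳ
    (AllPairs.map (λ c≉d {_} c≗ d≗ → c≉d λ x → trans (c≗ x) (sym (d≗ x))) (colorings-distinct G n))
    (AllPairs-concatMap (partitions-distinct G K)
      (λ { {k , r} π∈ → AllPairs.map⁺ (AllPairs.map
         (λ ι≉κ {_} c≗ιr c≗κr → ι≉κ
           (surjective-epi (proj₂ (∈-partitions⇒ G K π∈)) λ x → trans (sym (c≗ιr x)) (c≗κr x)))
         (injections-distinct k n)) })
      λ _ _ r≉s d∈ e∈ {_} fd fe → r≉s (same-kernel d∈ e∈ fd fe)))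
  (trans (length-concatMap _ (partitions G K))
         (∑-cong (λ { (k , r) → trans (length-map _ (injections k n)) (length-injections k n) }) (partitions G K)))
  where
  Coloured : Set
  Coloured = Σ (Partition G) λ (k , _) → Fin k → Fin n

  coloured : Partition G → List Coloured
  coloured π = map (π ,_) (injections (proj₁ π) n)

  Factors : (Fin (order G) → Fin n) → Coloured → Set
  Factors c ((k , r) , ι) = c ≗ ι ∘ r

  surjective-epi : ∀ {k} {r : Fin (order G) → Fin k} {ι κ : Fin k → Fin n} → Surjective r → ι ∘ r ≗ κ ∘ r → ι ≗ κ
  surjective-epi surj eq j with x , refl ← surj j = eq x

  coverˡ : ∀ {c} → c ∈ colorings G n → ∃ λ d → d ∈ concatMap coloured (partitions G K) × Factors c d
  coverˡ {c} c∈
    with k , r , π∈ , c≼r , r≼c ← partitions-complete G K N<K (∈-colorings⇒Proper G c∈)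
    with _ , surj ← ∈-partitions⇒ G K π∈
    -- `ι` reads the color of each class off a chosen preimage; it is injective because `c ≼ r`.
    with ι , ι∈ , ι≗ ← injections-complete k n (λ j → c (proj₁ (surj j)))
           (λ {i} {j} eq → trans (sym (proj₂ (surj i))) (trans (c≼r eq) (proj₂ (surj j)))) =
      ((k , r) , ι)
    , ∈-concatMap⁺ coloured (lose π∈ (∈-map⁺ _ ι∈))
    , λ x → sym (trans (ι≗ (r x)) (r≼c (proj₂ (surj (r x)))))

  same-kernel : ∀ {π ρ c d e} → d ∈ coloured π → e ∈ coloured ρ → Factors c d → Factors c e → proj₂ π ≈ proj₂ ρ
  same-kernel {k , r} {l , s} {c} d∈ e∈ c≗d c≗e
    with ι , ι∈ , refl ← ∈-map⁻ _ d∈ | κ , κ∈ , refl ← ∈-map⁻ _ e∈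
    with c≼r , r≼c ← injective-∘-≈ {c = c} {r} (∈-injections⇒injective k n ι∈) c≗d
       | c≼s , s≼c ← injective-∘-≈ {c = c} {s} (∈-injections⇒injective l n κ∈) c≗e =
      (λ eq → c≼s (r≼c eq)) , (λ eq → c≼r (s≼c eq))

  coverʳ : ∀ {d} → d ∈ concatMap coloured (partitions G K) → ∃ λ c → c ∈ colorings G n × Factors c d
  coverʳ d∈ with (k , r) , π∈ , d∈π ← find (∈-concatMap⁻ coloured {xs = partitions G K} d∈)
    with ι , ι∈ , refl ← ∈-map⁻ _ d∈π =
      colorings-complete G λ xy eq → proj₁ (∈-partitions⇒ G K π∈) xy (∈-injections⇒injective k n ι∈ eq)

-- Multiplicativity under disjoint union

module _ (G H : Graph) where

  private
    N = order G
    M = order H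

  Proper-∪ˡ : {c : Fin (N + M) → Fin n} → Proper (G ∪ H) c → Proper G (c ∘ (_↑ˡ M))
  Proper-∪ˡ proper {x} {y} xy = proper (subst T (sym adj-eq) xy)
    where
    adj-eq : adj (G ∪ H) (x ↑ˡ M) (y ↑ˡ M) ≡ adj G x y
    adj-eq rewrite splitAt-↑ˡ N x M | splitAt-↑ˡ N y M = refl

  Proper-∪ʳ : {c : Fin (N + M) → Fin n} → Proper (G ∪ H) c → Proper H (c ∘ (N ↑ʳ_))
  Proper-∪ʳ proper {x} {y} xy = proper (subst T (sym adj-eq) xy)
    where
    adj-eq : adj (G ∪ H) (N ↑ʳ x) (N ↑ʳ y) ≡ adj H x y
    adj-eq rewrite splitAt-↑ʳ N M x | splitAt-↑ʳ N M y = refl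

  Proper-∪ : {a : Fin N → Fin n} {b : Fin M → Fin n} → Proper G a → Proper H b →
    Proper (G ∪ H) ([ a , b ]′ ∘ splitAt N)
  Proper-∪ proper-a proper-b {x} {y} xy with splitAt N x | splitAt N y
  -- The mixed cases are empty: `unionAdj` is `false` between the two parts.
  ... | inj₁ _ | inj₁ _ = proper-a xy
  ... | inj₂ _ | inj₂ _ = proper-b xy

  -- A coloring of the union corresponds to its pair of restrictions; any two proper colorings glue,
  -- since no edge joins the parts.
  chromatic-∪ : ∀ n → chromatic (G ∪ H) n ≡ chromatic G n * chromatic H n
  chromatic-∪ n = trans
    (double-count Restricts
      (λ {c} c∈ → let proper = ∈-colorings⇒Proper (G ∪ H) c∈
                      a , a∈ , a≗ = colorings-complete G (Proper-∪ˡ {c = c} proper)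
                      b , b∈ , b≗ = colorings-complete H (Proper-∪ʳ {c = c} proper)
        in (a , b) , ∈-concatMap⁺ _ (lose a∈ (∈-map⁺ _ b∈)) , (λ x → sym (a≗ x)) , (λ y → sym (b≗ y)))
      glue
      (AllPairs.map (λ { c≉d {_} (c≗a , c≗b) (d≗a , d≗b) → c≉d (agree c≗a c≗b d≗a d≗b) })
        (colorings-distinct (G ∪ H) n))
      (AllPairs-concatMap (colorings-distinct G n)
        (λ _ → AllPairs.map⁺ (AllPairs.map
          (λ { b≉d {_} (_ , c≗b) (_ , c≗d) → b≉d λ y → trans (sym (c≗b y)) (c≗d y) })
                                (colorings-distinct H n)))
        λ _ _ a≉a′ p∈ q∈ {_} (c≗a , _) (c≗a′ , _) →
          a≉a′ λ x → trans (sym (first p∈ c≗a x)) (first q∈ c≗a′ x)))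
    (trans (length-concatMap _ (colorings G n))
    (trans (∑-cong (λ a → length-map (a ,_) (colorings H n)) (colorings G n))
           (∑-const (chromatic H n) (colorings G n))))
    where
    Pair : Set
    Pair = (Fin N → Fin n) × (Fin M → Fin n)

    pairs : (Fin N → Fin n) → List Pair
    pairs a = map (a ,_) (colorings H n)

    Restricts : (Fin (N + M) → Fin n) → Pair → Set
    Restricts c (a , b) = (c ∘ (_↑ˡ M) ≗ a) × (c ∘ (N ↑ʳ_) ≗ b)

    first : ∀ {a p} {f : Fin N → Fin n} → p ∈ pairs a → f ≗ proj₁ p → f ≗ a
    first p∈ f≗ with _ , _ , refl ← ∈-map⁻ _ p∈ = f≗

    agree : ∀ {c d : Fin (N + M) → Fin n} {a b} → c ∘ (_↑ˡ M) ≗ a → c ∘ (N ↑ʳ_) ≗ b →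
      d ∘ (_↑ˡ M) ≗ a → d ∘ (N ↑ʳ_) ≗ b → c ≗ d
    agree c≗a c≗b d≗a d≗b x with splitAt N x in eq
    ... | inj₁ i rewrite sym (splitAt⁻¹-↑ˡ {i = x} eq) = trans (c≗a i) (sym (d≗a i))
    ... | inj₂ j rewrite sym (splitAt⁻¹-↑ʳ {i = x} eq) = trans (c≗b j) (sym (d≗b j))

    glue : ∀ {p} → p ∈ concatMap pairs (colorings G n) → ∃ λ c → c ∈ colorings (G ∪ H) n × Restricts c p
    glue p∈ with a , a∈ , p∈a ← find (∈-concatMap⁻ pairs {xs = colorings G n} p∈)
      with b , b∈ , refl ← ∈-map⁻ _ p∈a
      with c , c∈ , c≗ ← colorings-complete (G ∪ H) (Proper-∪ (∈-colorings⇒Proper G a∈) (∈-colorings⇒Proper H b∈)) =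
        c , c∈
      , (λ x → trans (c≗ (x ↑ˡ M)) (cong [ a , b ]′ (splitAt-↑ˡ N x M)))
      , (λ y → trans (c≗ (N ↑ʳ y)) (cong [ a , b ]′ (splitAt-↑ʳ N M y)))

-- Expanding `𝓑` and `𝓣`

S-zero : ∀ G → 0 < order G → S G 0 ≡ 0
S-zero G N>0 with kColorings G 0
... | []    = refl
... | c ∷ _ with () ← c (fromℕ< N>0)

-- The only function from the empty vertex set to `suc k` colors is not surjective, so `S` computes
-- to 0 there.
S-suc⇒0<order : ∀ G k → 0 < S G (suc k) → 0 < order G
S-suc⇒0<order record { order = zero }  k ()
S-suc⇒0<order record { order = suc _ } k _ = z<s

-- Each `k` up to `order G` occurs `S G k` times; the bound is exclusive, hence the `suc`.
sizes : Graph → List ℕ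
sizes G = map proj₁ (partitions G (suc (order G)))

chromatic-sizes : ∀ G n → chromatic G n ≡ ∑ (sizes G) (n P′_)
chromatic-sizes G n = trans (chromatic-expansion G _ (n<1+n (order G)) n)
  (sym (∑-map proj₁ (n P′_) (partitions G (suc (order G)))))

∑-sizes : ∀ G → 0 < order G → (h : ℕ → ℕ) → ∑ (sizes G) h ≡ ∑ (ks G) (λ k → S G k * h k)
∑-sizes G N>0 h = begin
  ∑ (sizes G) h                               ≡⟨ ∑-map proj₁ h (partitions G (suc (order G))) ⟩
  ∑ (partitions G (suc (order G))) (h ∘ proj₁) ≡⟨ ∑-partitions G (suc (order G)) h ⟩
  -- `upTo` starts at 0 and `ks` at 1; the extra term vanishes by `S-zero`.
  ∑ (upTo (suc (order G))) (λ k → S G k * h k) ≡⟨ cong₂ (λ s ls → s * h 0 + ∑ ls (λ k → S G k * h k))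
                                                    (S-zero G N>0) (sym (map-upTo suc (order G))) ⟩
  ∑ (ks G) (λ k → S G k * h k)                 ∎
  where open ≡-Reasoning

𝓑≡ : ∀ G → 0 < order G → 𝓑 G ≡ ∑ (sizes G) (const 1)
𝓑≡ G N>0 = sym (trans (∑-sizes G N>0 (const 1)) (∑-cong (λ k → *-identityʳ (S G k)) (ks G)))

𝓣≡ : ∀ G → 0 < order G → 𝓣 G ≡ ∑ (sizes G) id
𝓣≡ G N>0 = sym (trans (∑-sizes G N>0 id) (∑-cong (λ k → *-comm (S G k) k) (ks G)))

-- The identity is a proper coloring with `order G` colors, so the chromatic polynomial is positive
-- there and its expansion cannot be empty. This includes the empty graph.
sizes-nonempty : ∀ G → 0 < ∑ (sizes G) (const 1)
sizes-nonempty G = nonempty (sizes G) (subst (0 <_) (chromatic-sizes G (order G)) (∈-length id∈))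
  where
  nonempty : ∀ xs {f : ℕ → ℕ} → 0 < ∑ xs f → 0 < ∑ xs (const 1)
  nonempty (_ ∷ _) _ = z<s

  id-proper : Proper G id
  id-proper {x} xy refl = subst T (irrefl G x) xy

  id∈ : proj₁ (colorings-complete G id-proper) ∈ colorings G (order G)
  id∈ = proj₁ (proj₂ (colorings-complete G id-proper))

-- A partition of `H` into `j` classes contributes `n P′ j` colorings, just as `K_j` does. Hence
-- extending the sizes of `G` by a `j`-clique for each such partition gives a list with the
-- chromatic polynomial of `G ∪ H`, and uniqueness of expansions passes from `n P′_` to every `h`.
∑-sizes-∪ : ∀ G H K → order H < K → (h : ℕ → ℕ) →
  ∑ (sizes (G ∪ H)) h ≡ ∑ (upTo K) (λ j → S H j * ∑ (extend (sizes G) j) (λ l → h (j + l)))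
∑-sizes-∪ G H K M<K h = begin
  ∑ (sizes (G ∪ H)) h  ≡⟨ P′-expansion-unique {sizes (G ∪ H)} {concatMap joined (partitions H K)} same-polynomial h ⟩
  ∑ (concatMap joined (partitions H K)) h  ≡⟨ ∑-joined h ⟩
  ∑ (partitions H K) (λ (j , _) → ∑ (extend (sizes G) j) (λ l → h (j + l)))
    ≡⟨ ∑-partitions H K (λ j → ∑ (extend (sizes G) j) (λ l → h (j + l))) ⟩
  ∑ (upTo K) (λ j → S H j * ∑ (extend (sizes G) j) (λ l → h (j + l))) ∎
  where
  open ≡-Reasoning

  joined : Partition H → List ℕ
  joined (j , _) = map (j +_) (extend (sizes G) j)

  ∑-joined : ∀ h → ∑ (concatMap joined (partitions H K)) h ≡
    ∑ (partitions H K) (λ (j , _) → ∑ (extend (sizes G) j) (λ l → h (j + l)))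
  ∑-joined h = trans (∑-concatMap joined h (partitions H K))
    (∑-cong (λ (j , _) → ∑-map (j +_) h (extend (sizes G) j)) (partitions H K))

  same-polynomial : ∀ n → ∑ (sizes (G ∪ H)) (n P′_) ≡ ∑ (concatMap joined (partitions H K)) (n P′_)
  same-polynomial n = begin
    ∑ (sizes (G ∪ H)) (n P′_)    ≡⟨ chromatic-sizes (G ∪ H) n ⟨
    chromatic (G ∪ H) n          ≡⟨ chromatic-∪ G H n ⟩
    chromatic G n * chromatic H n
      ≡⟨ *-comm (chromatic G n) _ ⟩
    chromatic H n * chromatic G n
      ≡⟨ cong₂ _*_ (chromatic-expansion H K M<K n) (chromatic-sizes G n) ⟩
    ∑ (partitions H K) (λ (j , _) → n P′ j) * ∑ (sizes G) (n P′_)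
      ≡⟨ ∑-*ʳ (∑ (sizes G) (n P′_)) (λ (j , _) → n P′ j) (partitions H K) ⟨
    ∑ (partitions H K) (λ (j , _) → (n P′ j) * ∑ (sizes G) (n P′_))
      ≡⟨ ∑-cong (λ (j , _) → ∑-extend-P′ (sizes G) j n) (partitions H K) ⟨
    ∑ (partitions H K) (λ (j , _) → ∑ (extend (sizes G) j) (λ l → n P′ (j + l)))
      ≡⟨ ∑-joined (n P′_) ⟨
    ∑ (concatMap joined (partitions H K)) (n P′_) ∎

-- Comparing the averages

𝓐-< : ∀ G H → 0 < 𝓑 G → 0 < 𝓑 H → 𝓣 G * 𝓑 H < 𝓣 H * 𝓑 G → 𝓐 G <ℚ 𝓐 H
𝓐-< G H 𝓑G>0 𝓑H>0 lt with 𝓑 G | 𝓑 H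
-- Positivity excludes the default value `0ℚᵘ`; `mkℚᵘ` stores the denominator minus one, so
-- cross-multiplication uses `suc b` and `suc d`.
... | suc b | suc d = *<* (subst₂ ℤ._<_ (pos-* (𝓣 G) (suc d)) (pos-* (𝓣 H) (suc b)) (+<+ lt))

theorem9 : (H₁ H₂ : Graph)
    → (∀ k k′ → 1 ≤ k′ → k′ < k → S H₂ k * S H₁ k′ ≤ S H₁ k * S H₂ k′)
    → (∃ λ k → ∃ λ k′ → 1 ≤ k′ × k′ < k × S H₂ k * S H₁ k′ < S H₁ k * S H₂ k′)
    → (G : Graph) → 𝓐 (G ∪ H₂) <ℚ 𝓐 (G ∪ H₁)
theorem9 H₁ H₂ weak (k@(suc _) , k′@(suc _) , _ , k′<k , strict) G =
  𝓐-< (G ∪ H₂) (G ∪ H₁) (𝓑>0 (G ∪ H₂) (G∪H>0 M₂>0)) (𝓑>0 (G ∪ H₁) (G∪H>0 M₁>0))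
    (subst₂ _<_ (cong₂ _*_ (sym (𝓣-∪ H₂ M₂>0 M₂<K)) (sym (𝓑-∪ H₁ M₁>0 M₁<K)))
                (cong₂ _*_ (sym (𝓣-∪ H₁ M₁>0 M₁<K)) (sym (𝓑-∪ H₂ M₂>0 M₂<K)))
      (dominance (S H₁) (S H₂) (total (sizes G)) (count (sizes G)) p≽q (ratio-increasing (sizes G) (sizes-nonempty G) ∘ <⇒<′)
        (∈-upTo⁺ (<-trans k′<k k<K)) (∈-upTo⁺ k<K) k′<k strict))
  where
  -- The strict pair forces both factors to be positive, so neither `H₁` nor `H₂` is empty.
  product>0 : 0 < S H₁ k * S H₂ k′
  product>0 = ≤-<-trans z≤n strict

  M₁>0 : 0 < order H₁
  M₁>0 = S-suc⇒0<order H₁ _ (n≢0⇒n>0 λ s≡0 → >⇒≢ product>0 (cong (_* S H₂ k′) s≡0))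

  M₂>0 : 0 < order H₂
  M₂>0 = S-suc⇒0<order H₂ _
    (n≢0⇒n>0 λ s≡0 → >⇒≢ product>0 (trans (cong (S H₁ k *_) s≡0) (*-zeroʳ (S H₁ k))))

  -- A common index range: above both orders for the expansions, and above `k` so that it contains
  -- the strict pair.
  K : ℕ
  K = suc (order H₁ + order H₂ + k)

  M₁<K : order H₁ < K
  M₁<K = s≤s (≤-trans (m≤m+n _ _) (m≤m+n _ k))

  M₂<K : order H₂ < K
  M₂<K = s≤s (≤-trans (m≤n+m _ (order H₁)) (m≤m+n _ k))

  k<K : k < K
  k<K = s≤s (m≤n+m k _)

  G∪H>0 : ∀ {M} → 0 < M → 0 < order G + M
  G∪H>0 M>0 = ≤-trans M>0 (m≤n+m _ (order G))

  𝓑>0 : ∀ F → 0 < order F → 0 < 𝓑 F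
  𝓑>0 F F>0 = subst (0 <_) (sym (𝓑≡ F F>0)) (sizes-nonempty F)

  𝓑-∪ : ∀ H → 0 < order H → order H < K → 𝓑 (G ∪ H) ≡ ∑ (upTo K) (λ j → S H j * count (sizes G) j)
  𝓑-∪ H M>0 M<K = trans (𝓑≡ (G ∪ H) (G∪H>0 M>0)) (∑-sizes-∪ G H K M<K (const 1))

  𝓣-∪ : ∀ H → 0 < order H → order H < K → 𝓣 (G ∪ H) ≡ ∑ (upTo K) (λ j → S H j * total (sizes G) j)
  𝓣-∪ H M>0 M<K = trans (𝓣≡ (G ∪ H) (G∪H>0 M>0)) (∑-sizes-∪ G H K M<K id)

  p≽q : ∀ {i j} → i < j → S H₂ j * S H₁ i ≤ S H₁ j * S H₂ i
  -- The hypothesis starts at index 1; at index 0 the left side vanishes because `S H₁ 0` is 0.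
  p≽q {zero}  {j} _   = ≤-trans (≤-reflexive (trans (cong (S H₂ j *_) (S-zero H₁ M₁>0)) (*-zeroʳ (S H₂ j)))) z≤n
  p≽q {suc i} {j} i<j = weak j (suc i) z<s i<j
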